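{- Let $\mathcal{R}$ be the set of rules of an LCTRS, $\mathcal{P}$ a set of dependency pairs, $\iota$ a sort and $\nu$ a projection function for $\mathcal{P}$, with the following property: for any dependency pair $l\to r\,[\varphi]\in\mathcal{P}$, if $\overline{\nu}(l)$ has sort $\iota$ and is a logical term (this includes variables), then the same holds for $\overline{\nu}(r)$. Let moreover $\succ$ be a well-founded ordering relation on $\mathcal{I}_\iota$ and $\succeq$ a quasi-ordering on $\mathcal{I}_\iota$ such that $\succ\cdot\succeq\;\subseteq\;\succ$. Suppose additionally that we can write $\mathcal{P}=\mathcal{P}_1\cup\mathcal{P}_2$, such that for all $\rho = l\to r\,[\varphi]\in\mathcal{P}$: \begin{itemize} \item if $\overline{\nu}(l)$ is a logical term of sort $\iota$, then so is $\overline{\nu}(r)$, and $\mathit{Var}(\overline{\nu}(r))\subseteq\mathit{Var}(\overline{\nu}(l))$; \item if $\rho\in\mathcal{P}_1$, then $\overline{\nu}(l)$ has sort $\iota$ and $\overline{\nu}(l)\in\mathcal{T}\mathit{erms}(\Sigma_{\mathit{theory}},\mathit{LVar}(\rho))$; \item if $\overline{\nu}(l)$ has sort $\iota$ and $\overline{\nu}(l)\in\mathcal{T}\mathit{erms}(\Sigma_{\mathit{theory}},\mathcal{V})$, then $\varphi\Rightarrow\overline{\nu}(l)\succ\overline{\nu}(r)$ is valid if $\rho\in\mathcal{P}_1$, and $\varphi\Rightarrow\overline{\nu}(l)\succeq\overline{\nu}(r)$ is valid if $\rho\in\mathcal{P}_2$. \end{itemize} Then $\mathcal{P}$ is chain-free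 if and only if $\mathcal{P}_2$ is chain-free.
   Context: Terms are many-sorted. Let $\mathcal{V}$ be an infinite set of sorted variables; let $\Sigma=\Sigma_{\mathit{terms}}\cup\Sigma_{\mathit{theory}}$ be a many-sorted signature; let $\mathcal{I}$ assign to each sort $\iota$ occurring in $\Sigma_{\mathit{theory}}$ a set $\mathcal{I}_\iota$; let $\mathcal{J}$ map each $f:[\iota_1\times\cdots\times\iota_n]\Rightarrow\kappa$ in $\Sigma_{\mathit{theory}}$ to a function $\mathcal{J}_f$ from $\mathcal{I}_{\iota_1},\ldots,\mathcal{I}_{\iota_n}$ to $\mathcal{I}_\kappa$. For each sort $\iota$ occurring in $\Sigma_{\mathit{theory}}$ fix a set $\mathcal{V}al_\iota\subseteq\Sigma_{\mathit{theory}}$ of values: constants of sort $\iota$ such that $\mathcal{J}$ gives a one-to-one mapping from $\mathcal{V}al_\iota$ to $\mathcal{I}_\iota$ (every element of $\mathcal{I}_\iota$ is represented by a unique value); $\mathcal{V}al$ is the set of all values. $\Sigma_{\mathit{terms}}$ and $\Sigma_{\mathit{theory}}$ overlap only on values. $\mathcal{T}\mathit{erms}(\Sigma',X)$ is the set of well-sorted terms over symbols $\Sigma'$ and variables $X$; $\mathit{Var}(s)$ is the set of variables of $s$. A logical term is an element of $\mathcal{T}\mathit{erms}(\Sigma_{\mathit{theory}},\mathcal{V})$. For ground logical terms, $[\![f(s_1,\ldots,s_n)]\!]:=\mathcal{J}_f([\![s_1]\!],\ldots,[\![s_n]\!])$; the value of a ground logical term $s$ is the unique value $t$ with $[\![s]\!]=[\![t]\!]$.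 A constraint is a logical term of a sort $\mathsf{bool}$ with $\mathcal{I}_{\mathsf{bool}}=\{\top,\bot\}$ (the booleans). A constraint or formula is valid if it evaluates to $\top$ under all substitutions mapping its variables to values; thus $\varphi\Rightarrow s\succ t$ is valid if for all substitutions $\gamma$ mapping the variables of $\varphi,s,t$ to values, $[\![\varphi\gamma]\!]=\top$ implies $[\![s\gamma]\!]\succ[\![t\gamma]\!]$ (and similarly for $\succeq$). A rule is a triple $l\to r\,[\varphi]$ where $l,r$ are terms of the same sort, $\varphi$ is a constraint, and $l$ is not a logical term (so also not a variable). $\mathit{LVar}(l\to r\,[\varphi]):=\mathit{Var}(\varphi)\cup(\mathit{Var}(r)\setminus\mathit{Var}(l))$. A substitution $\gamma$ respects $l\to r\,[\varphi]$ if $\gamma(x)$ is a value for all $x\in\mathit{LVar}(l\to r\,[\varphi])$ and $\varphi\gamma$ is valid. An LCTRS is given by such a setting with a set $\mathcal{R}$ of rules; $\to_{\mathcal{R}}$ is the union of $\to_{\mathtt{rule}}$ and $\to_{\mathtt{calc}}$, where $C[l\gamma]\to_{\mathtt{rule}}C[r\gamma]$ if $l\to r\,[\varphi]\in\mathcal{R}$ and $\gamma$ respects $l\to r\,[\varphi]$; and $C[f(s_1,\ldots,s_n)]\to_{\mathtt{calc}}C[v]$ if $f\in\Sigma_{\mathit{theory}}\setminus\Sigma_{\mathit{terms}}$, all $s_i$ are values and $v$ is the value of $f(s_1,\ldots,s_n)$. Defined symbols are all symbols $f$ such that $\mathcal{R}$ contains a rule of the form $f(\vec{l})\to r\,[\varphi]$.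 Dependency pairs: introduce a fresh sort $\mathsf{dpsort}$ and, for each defined symbol $f:[\iota_1\times\cdots\times\iota_n]\Rightarrow\kappa$, a new symbol $f^\sharp:[\iota_1\times\cdots\times\iota_n]\Rightarrow\mathsf{dpsort}$. If $s=f(s_1,\ldots,s_n)$ with $f$ defined, then $s^\sharp:=f^\sharp(s_1,\ldots,s_n)$. The dependency pairs of a rule $l\to r\,[\varphi]$ are all rules $l^\sharp\to p^\sharp\,[\varphi]$ where $p$ is a subterm of $r$ headed by a defined symbol. The set $\mathcal{R}$ of rules is fixed. Given a set $\mathcal{P}$ of dependency pairs, a $\mathcal{P}$-chain is a sequence $\rho_1,\rho_2,\ldots$ of elements of $\mathcal{P}$, each with distinctly renamed variables, such that there is a substitution $\gamma$ which respects all $\rho_i$ and such that for all $i$: if $\rho_i=l_i\to p_i\,[\varphi_i]$ and $\rho_{i+1}=l_{i+1}\to p_{i+1}\,[\varphi_{i+1}]$, then $p_i\gamma\to_{\mathcal{R}}^* l_{i+1}\gamma$; moreover the strict subterms of each $l_i\gamma$ are terminating with respect to $\to_{\mathcal{R}}$. (The single substitution $\gamma$ may have infinite domain.) $\mathcal{P}$ is chain-free if there is no infinite $\mathcal{P}$-chain. A projection function for $\mathcal{P}$ is a function $\nu$ which assigns to each symbol $f^\sharp:[\iota_1\times\cdots\times\iota_n]\Rightarrow\mathsf{dpsort}$ a number $\nu(f^\sharp)\in\{1,\ldots,n\}$. It is extended to terms by $\overline{\nu}(f^\sharp(s_1,\ldots,s_n)):=s_{\nu(f^\sharp)}$. -}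

module Defs where

open import Data.Bool using (Bool; true)
open import Data.Empty using (⊥)
open import Data.Fin using (Fin)
open import Data.List using (List; []; _∷_; length; lookup)
open import Data.List.Membership.Propositional using () renaming (_∈_ to _∈ˡ_)
open import Data.List.Membership.Propositional.Properties using (∈-lookup)
open import Data.List.Relation.Unary.All as All using (All; []; _∷_; _[_]≔_)
open import Data.List.Relation.Unary.Any using (here; there)
open import Data.Nat using (ℕ; suc)
open import Data.Product using (Σ; ∃; ∃₂; Σ-syntax; ∃-syntax; _×_; _,_)
open import Data.Sum using (_⊎_)
open import Data.Unit using (⊤; tt)
open import Function using (flip; _↣_; _↔_; Inverse)
open import Function.Definitions using (Injective; Bijective)
open import Induction.WellFounded using (Acc)
open import Level using (0ℓ)
open import Relation.Binary.Core using (Rel)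
open import Relation.Binary.Construct.Closure.ReflexiveTransitive using (Star)
open import Relation.Binary.PropositionalEquality using (_≡_; _≢_; refl; subst; sym)
open import Relation.Nullary using (¬_)
open import Relation.Unary using (Pred; _∈_; _∉_; _⊆_; _∪_; _∖_; ∅; U)

-- Σ_terms and Σ_theory overlap only on values, so Σ_terms ∪ Σ_theory is the
-- disjoint union of
--   TermSym   = Σ_terms ∖ Σ_theory,
--   TheorySym = Σ_theory ∖ 𝒱al,
--   Val       = 𝒱al ⊆ Σ_theory,
-- and SharedVal singles out the values that also belong to Σ_terms.
-- A symbol f : [ι₁ × ⋯ × ιₙ] ⇒ κ is an element of the family at (ι₁ ∷ ⋯ ∷ ιₙ ∷ []) and κ.
record Signature : Set₁ where
  field
    Sort         : Set
    Var          : Sort → Set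
    Var-infinite : ℕ ↣ ∃ Var
    TermSym      : List Sort → Sort → Set
    TheorySym    : List Sort → Sort → Set
    Val          : Sort → Set
    SharedVal    : ∀ {κ} → Pred (Val κ) 0ℓ

module Terms (𝓢 : Signature) where
  open Signature 𝓢 public

  data Sym : List Sort → Sort → Set where
    termSym   : ∀ {ιs κ} → TermSym ιs κ → Sym ιs κ
    theorySym : ∀ {ιs κ} → TheorySym ιs κ → Sym ιs κ
    value     : ∀ {κ} → Val κ → Sym [] κ

  Σterms : ∀ {ιs κ} → Pred (Sym ιs κ) 0ℓ
  Σterms (termSym _)   = ⊤
  Σterms (theorySym _) = ⊥
  Σterms (value v)     = SharedVal v

  Σtheory : ∀ {ιs κ} → Pred (Sym ιs κ) 0ℓ
  Σtheory (termSym _)   = ⊥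
  Σtheory (theorySym _) = ⊤
  Σtheory (value _)     = ⊤

  OccursInΣtheory : Pred Sort 0ℓ
  OccursInΣtheory ι =
    ∃[ ιs ] ∃[ κ ] Σ[ f ∈ Sym ιs κ ] f ∈ Σtheory × (ι ≡ κ ⊎ ι ∈ˡ ιs)

  data Term : Sort → Set where
    var : ∀ {κ} → Var κ → Term κ
    fun : ∀ {ιs κ} → Sym ιs κ → All Term ιs → Term κ

  VarSet : Set₁
  VarSet = Pred (∃ Var) 0ℓ

  -- Below, a proof p : ι ∈ˡ ιs is an argument position of sort ι.
  data Vars : ∀ {κ} → Term κ → VarSet where
    here : ∀ {κ} {x : Var κ} → Vars (var x) (κ , x)
    arg  : ∀ {ιs κ ι x} {f : Sym ιs κ} {ts : All Term ιs} (p : ι ∈ˡ ιs) →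
           x ∈ Vars (All.lookup ts p) → Vars (fun f ts) x

  data _⊴_ {κ} (s : Term κ) : ∀ {κ′} → Term κ′ → Set where
    self : s ⊴ s
    arg  : ∀ {ιs κ′ ι} {f : Sym ιs κ′} {ts : All Term ιs} (p : ι ∈ˡ ιs) →
           s ⊴ All.lookup ts p → s ⊴ fun f ts

  -- TheoryTerms X is 𝒯erms(Σ_theory, X).
  data TheoryTerms (X : VarSet) : ∀ {κ} → Pred (Term κ) 0ℓ where
    var : ∀ {κ} {x : Var κ} → (κ , x) ∈ X → TheoryTerms X (var x)
    fun : ∀ {ιs κ} {f : Sym ιs κ} {ts : All Term ιs} → f ∈ Σtheory →
          (∀ {ι} (p : ι ∈ˡ ιs) → TheoryTerms X (All.lookup ts p)) →
          TheoryTerms X (fun f ts)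

  Logical : ∀ {κ} → Pred (Term κ) 0ℓ
  Logical = TheoryTerms U

  GroundLogical : ∀ {κ} → Pred (Term κ) 0ℓ
  GroundLogical = TheoryTerms ∅

  data IsValue : ∀ {κ} → Pred (Term κ) 0ℓ where
    isValue : ∀ {κ} (v : Val κ) → IsValue (fun (value v) [])

  Subst : Set
  Subst = ∀ {κ} → Var κ → Term κ

  infixl 8 _[_] _[_]*

  mutual
    _[_] : ∀ {κ} → Term κ → Subst → Term κ
    var x    [ γ ] = γ x
    fun f ts [ γ ] = fun f (ts [ γ ]*)

    _[_]* : ∀ {ιs} → All Term ιs → Subst → All Term ιs
    []       [ γ ]* = []
    (t ∷ ts) [ γ ]* = (t [ γ ]) ∷ (ts [ γ ]*)

  MapsToValues : Subst → Pred VarSet 0ℓ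
  MapsToValues γ X = ∀ {κ} {x : Var κ} → (κ , x) ∈ X → IsValue (γ x)

  Renaming : Set
  Renaming = ∀ {κ} → Var κ → Var κ

  ⟨_⟩ : Renaming → Subst
  ⟨ π ⟩ x = var (π x)

  lookup-[] : ∀ {ιs ι} (ts : All Term ιs) (γ : Subst) (p : ι ∈ˡ ιs) →
              All.lookup (ts [ γ ]*) p ≡ All.lookup ts p [ γ ]
  lookup-[] (t ∷ ts) γ (here refl) = refl
  lookup-[] (t ∷ ts) γ (there p)   = lookup-[] ts γ p

  rename-logical : ∀ {κ} {t : Term κ} (π : Renaming) → Logical t → Logical (t [ ⟨ π ⟩ ])
  rename-logical π (var _) = var _
  rename-logical π (fun {ts = ts} f∈ ts∈) =
    fun f∈ λ p → subst Logical (sym (lookup-[] ts ⟨ π ⟩ p)) (rename-logical π (ts∈ p))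

  data Closure (Root : ∀ {κ} → Rel (Term κ) 0ℓ) : ∀ {κ} → Rel (Term κ) 0ℓ where
    root : ∀ {κ} {s t : Term κ} → Root s t → Closure Root s t
    arg  : ∀ {ιs κ ι} {f : Sym ιs κ} {ts : All Term ιs} (p : ι ∈ˡ ιs) {t : Term ι} →
           Closure Root (All.lookup ts p) t →
           Closure Root (fun f ts) (fun f (ts [ p ]≔ t))

-- 𝓘 is a total function for convenience only: nothing is required of 𝓘 ι when
-- ι does not occur in Σ_theory.
record Theory (𝓢 : Signature) : Set₁ where
  open Terms 𝓢
  field
    𝓘            : Sort → Set
    𝓙-fun        : ∀ {ιs κ} → TheorySym ιs κ → All 𝓘 ιs → 𝓘 κ
    𝓙-val        : ∀ {κ} → Val κ → 𝓘 κ
    𝓙-val-unique : ∀ {κ} → OccursInΣtheory κ → Bijective _≡_ _≡_ (𝓙-val {κ})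
    bool         : Sort
    bool-occurs  : OccursInΣtheory bool
    𝓘-bool       : 𝓘 bool ↔ Bool

module Rules (𝓢 : Signature) (𝓣 : Theory 𝓢) where
  open Terms 𝓢 public
  open Theory 𝓣 public

  𝓙 : ∀ {ιs κ} (f : Sym ιs κ) → f ∈ Σtheory → All 𝓘 ιs → 𝓘 κ
  𝓙 (theorySym f) _ as = 𝓙-fun f as
  𝓙 (value v)     _ _  = 𝓙-val v

  ⟦_⟧ : ∀ {κ} {t : Term κ} → GroundLogical t → 𝓘 κ
  ⟦ fun {f = f} f∈ ts∈ ⟧ = 𝓙 f f∈ (All.tabulate λ p → ⟦ ts∈ p ⟧)

  infix 4 _⇓_

  -- t is a ground logical term and ⟦ t ⟧ = a.
  _⇓_ : ∀ {κ} → Term κ → 𝓘 κ → Set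
  t ⇓ a = Σ[ g ∈ GroundLogical t ] ⟦ g ⟧ ≡ a

  _IsValueOf_ : ∀ {κ} → Term κ → Term κ → Set
  v IsValueOf s = IsValue v × ∃[ a ] (s ⇓ a × v ⇓ a)

  true𝓘 : 𝓘 bool
  true𝓘 = Inverse.from 𝓘-bool true

  Valid : Pred (Term bool) 0ℓ
  Valid φ = ∀ (γ : Subst) → MapsToValues γ (Vars φ) → φ [ γ ] ⇓ true𝓘

  Valid[_⇒_⟨_⟩_] : ∀ {κ} → Term bool → Term κ → Rel (𝓘 κ) 0ℓ → Term κ → Set
  Valid[ φ ⇒ s ⟨ _∼_ ⟩ t ] =
    ∀ (γ : Subst) → MapsToValues γ (Vars φ ∪ Vars s ∪ Vars t) →
    φ [ γ ] ⇓ true𝓘 →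
    ∃₂ λ a b → s [ γ ] ⇓ a × t [ γ ] ⇓ b × a ∼ b

  record Rule (κ : Sort) : Set where
    field
      lhs             : Term κ
      rhs             : Term κ
      constraint      : Term bool
      constraint-log  : Logical constraint
      lhs-not-logical : ¬ Logical lhs

    LVar : VarSet
    LVar = Vars constraint ∪ (Vars rhs ∖ Vars lhs)

    RespectedBy : Pred Subst 0ℓ
    RespectedBy γ = MapsToValues γ LVar × Valid (constraint [ γ ])

  RuleSet : Set₁
  RuleSet = ∀ {κ} → Pred (Rule κ) 0ℓ

module LCTRS (𝓢 : Signature) (𝓣 : Theory 𝓢) (R : Rules.RuleSet 𝓢 𝓣) where
  open Rules 𝓢 𝓣 public

  -- Root steps; C[s] → C[t] is the closure of these under term contexts.
  data RuleRoot : ∀ {κ} → Rel (Term κ) 0ℓ where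
    rule : ∀ {κ} (ρ : Rule κ) → R ρ → (γ : Subst) → Rule.RespectedBy ρ γ →
           RuleRoot (Rule.lhs ρ [ γ ]) (Rule.rhs ρ [ γ ])

  data CalcRoot : ∀ {κ} → Rel (Term κ) 0ℓ where
    calc : ∀ {ιs κ} (f : Sym ιs κ) (ts : All Term ιs) {v : Term κ} →
           f ∈ Σtheory → f ∉ Σterms →
           (∀ {ι} (p : ι ∈ˡ ιs) → IsValue (All.lookup ts p)) →
           v IsValueOf fun f ts →
           CalcRoot (fun f ts) v

  infix 4 _→rule_ _→calc_ _→R_

  _→rule_ _→calc_ _→R_ : ∀ {κ} → Rel (Term κ) 0ℓ
  _→rule_ = Closure RuleRoot
  _→calc_ = Closure CalcRoot
  s →R t  = s →rule t ⊎ s →calc t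

  Terminating : ∀ {κ} → Pred (Term κ) 0ℓ
  Terminating = Acc (flip _→R_)

  Defined : ∀ {ιs κ} → Pred (Sym ιs κ) 0ℓ
  Defined {ιs} {κ} f = Σ[ ρ ∈ Rule κ ] R ρ × ∃[ ts ] Rule.lhs ρ ≡ fun f ts

  -- The terms of sort dpsort.  As dpsort is fresh, it has no variables and is
  -- not an argument sort, so every such term is f♯(s₁, …, sₙ) for a defined
  -- symbol f and terms sᵢ over the original signature.  The proof that f is
  -- defined is irrelevant, so there is only one symbol f♯ for each f.
  data Term♯ : Set where
    sharp : ∀ {ιs κ} (f : Sym ιs κ) → .(Defined f) → All Term ιs → Term♯

  infixl 8 _[_]♯

  _[_]♯ : Term♯ → Subst → Term♯
  sharp f d ts [ γ ]♯ = sharp f d (ts [ γ ]*)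

  data Vars♯ : Term♯ → VarSet where
    arg : ∀ {ιs κ ι x} {f : Sym ιs κ} .{d : Defined f} {ts : All Term ιs} (p : ι ∈ˡ ιs) →
          x ∈ Vars (All.lookup ts p) → Vars♯ (sharp f d ts) x

  data _⊲♯_ {κ} (s : Term κ) : Term♯ → Set where
    arg : ∀ {ιs κ′ ι} {f : Sym ιs κ′} .{d : Defined f} {ts : All Term ιs} (p : ι ∈ˡ ιs) →
          s ⊴ All.lookup ts p → s ⊲♯ sharp f d ts

  infix 4 _→R♯_

  -- →R on terms of sort dpsort: no rule or calculation applies at the root,
  -- as the sides of rules and calculations have an original sort.
  data _→R♯_ : Rel Term♯ 0ℓ where
    arg : ∀ {ιs κ ι} {f : Sym ιs κ} .{d : Defined f} {ts : All Term ιs}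
          (p : ι ∈ˡ ιs) {t : Term ι} → All.lookup ts p →R t →
          sharp f d ts →R♯ sharp f d (ts [ p ]≔ t)

  record Rule♯ : Set where
    field
      lhs            : Term♯
      rhs            : Term♯
      constraint     : Term bool
      constraint-log : Logical constraint

    LVar : VarSet
    LVar = Vars constraint ∪ (Vars♯ rhs ∖ Vars♯ lhs)

    AllVars : VarSet
    AllVars = Vars♯ lhs ∪ Vars♯ rhs ∪ Vars constraint

    RespectedBy : Pred Subst 0ℓ
    RespectedBy γ = MapsToValues γ LVar × Valid (constraint [ γ ])

    rename : Renaming → Rule♯
    rename π = record
      { lhs            = lhs [ ⟨ π ⟩ ]♯
      ; rhs            = rhs [ ⟨ π ⟩ ]♯
      ; constraint     = constraint [ ⟨ π ⟩ ]
      ; constraint-log = rename-logical π constraint-log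
      }

  data _∈DP_ {κ} : Rule♯ → Rule κ → Set where
    dp : ∀ {ιs ιs′ κ′} {ρ : Rule κ}
         {f : Sym ιs κ} {ss : All Term ιs} .(f-def : Defined f) →
         Rule.lhs ρ ≡ fun f ss →
         {g : Sym ιs′ κ′} {ts : All Term ιs′} .(g-def : Defined g) →
         fun g ts ⊴ Rule.rhs ρ →
         record { lhs            = sharp f f-def ss
                ; rhs            = sharp g g-def ts
                ; constraint     = Rule.constraint ρ
                ; constraint-log = Rule.constraint-log ρ
                } ∈DP ρ

  DependencyPair : Pred Rule♯ 0ℓ
  DependencyPair δ = ∃[ κ ] Σ[ ρ ∈ Rule κ ] R ρ × δ ∈DP ρ

  record InfiniteChain (P : Pred Rule♯ 0ℓ) : Set where
    field
      pair           : ℕ → Rule♯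
      pair∈P         : ∀ i → pair i ∈ P
      π              : ℕ → Renaming
      π-injective    : ∀ i {κ} → Injective _≡_ _≡_ (π i {κ})

    renamed : ℕ → Rule♯
    renamed i = Rule♯.rename (pair i) (π i)

    field
      disjoint       : ∀ {i j} → i ≢ j → ∀ {x} →
                       x ∈ Rule♯.AllVars (renamed i) → x ∉ Rule♯.AllVars (renamed j)
      γ              : Subst
      respects       : ∀ i → Rule♯.RespectedBy (renamed i) γ
      connected      : ∀ i → Star _→R♯_ (Rule♯.rhs (renamed i) [ γ ]♯)
                                        (Rule♯.lhs (renamed (suc i)) [ γ ]♯)
      minimal        : ∀ i {κ} {s : Term κ} →
                       s ⊲♯ (Rule♯.lhs (renamed i) [ γ ]♯) → Terminating s

  ChainFree : Pred (Pred Rule♯ 0ℓ) 0ℓ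
  ChainFree P = ¬ InfiniteChain P

  Projection : Set
  Projection = ∀ {ιs κ} (f : Sym ιs κ) → .(Defined f) → Fin (length ιs)

  -- ν̄; the sort of the projected term depends on ν, so it is part of the result.
  project : Projection → Term♯ → ∃ Term
  project ν (sharp {ιs} f d ts) = lookup ιs (ν f d) , All.lookup ts (∈-lookup (ν f d))

  HasSort : Sort → Pred (∃ Term) 0ℓ
  HasSort ι (κ , _) = κ ≡ ι

  Logical′ : Pred (∃ Term) 0ℓ
  Logical′ (_ , t) = Logical t

  TheoryTerms′ : VarSet → Pred (∃ Term) 0ℓ
  TheoryTerms′ X (_ , t) = TheoryTerms X t

  Vars′ : ∃ Term → VarSet
  Vars′ (_ , t) = Vars t

{-# OPTIONS --safe #-}

-- Rules never apply to a ground logical term, because an instance of a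
-- non-logical left-hand side is not logical; calculation steps preserve its
-- value.  Hence, once ν̄(lᵢ)γ is a ground logical term of sort ι, so are all later
-- ν̄(lⱼ)γ, and their values decrease weakly on 𝒫₂ and strictly on 𝒫₁.  As ν̄(lᵢ)γ is
-- ground logical whenever ρᵢ ∈ 𝒫₁, well-founded induction on its value shows that,
-- if 𝒫₂ is chain-free, no pair of an infinite 𝒫-chain lies in 𝒫₁.
module Submission where

open import Defs
open import Data.Empty using (⊥-elim)
open import Data.List using (List; []; _∷_)
open import Data.List.Membership.Propositional using () renaming (_∈_ to _∈ˡ_)
open import Data.List.Membership.Propositional.Properties using (∈-lookup)
open import Data.List.Relation.Unary.All as All using (All; []; _∷_; _[_]≔_)
open import Data.List.Relation.Unary.Any using (here; there)
open import Data.Nat using (ℕ; zero; suc; _+_)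
open import Data.Nat.Properties using (+-cancelʳ-≡)
open import Data.Product using (∃; ∃-syntax; Σ-syntax; _×_; _,_; proj₁; proj₂)
open import Data.Sum as Sum using (_⊎_; inj₁; inj₂)
open import Data.Unit using (tt)
open import Function using (flip; _⇔_; mk⇔)
open import Function.Definitions using (Injective)
open import Induction.WellFounded using (WellFounded; Acc; acc)
open import Level using (0ℓ)
open import Relation.Binary using (Rel; IsStrictPartialOrder; IsPreorder)
open import Relation.Binary.Construct.Closure.ReflexiveTransitive using (Star; ε; _◅_)
open import Relation.Binary.PropositionalEquality
  using (_≡_; refl; sym; trans; cong; cong₂; subst; subst₂)
open import Relation.Nullary using (¬_; Dec; yes; no)
open import Relation.Unary using (Pred; _∈_; _∉_; _⊆_; _∪_; _≐_; _∩_)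

-- Argument tuples.

tabulate-cong : ∀ {A : Set} {P : A → Set} {xs : List A} {f g : ∀ {x} → x ∈ˡ xs → P x} →
                (∀ {x} (p : x ∈ˡ xs) → f p ≡ g p) →
                All.tabulate {P = P} f ≡ All.tabulate g
tabulate-cong {xs = []}     f≗g = refl
tabulate-cong {xs = x ∷ xs} f≗g =
  cong₂ _∷_ (f≗g (here refl)) (tabulate-cong (λ p → f≗g (there p)))

-- The disjunction avoids comparing `i` with `j`, whose types may differ. It tracks what a step in
-- one argument does to another given argument.
lookup-≔ : ∀ {A : Set} {P : A → Set} (_∼_ : ∀ {x} → Rel (P x) 0ℓ) {xs : List A} {x y}
           (ps : All P xs) (i : x ∈ˡ xs) {p : P x} → All.lookup ps i ∼ p → (j : y ∈ˡ xs) →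
           All.lookup (ps [ i ]≔ p) j ≡ All.lookup ps j ⊎
           All.lookup ps j ∼ All.lookup (ps [ i ]≔ p) j
lookup-≔ _∼_ (q ∷ ps) (here refl) q∼p (here refl) = inj₂ q∼p
lookup-≔ _∼_ (q ∷ ps) (here refl) q∼p (there j)   = inj₁ refl
lookup-≔ _∼_ (q ∷ ps) (there i)   q∼p (here refl) = inj₁ refl
lookup-≔ _∼_ (q ∷ ps) (there i)   q∼p (there j)   = lookup-≔ _∼_ ps i q∼p j

-- Substitution, renaming and ground logical terms.

module TermProperties (𝓢 : Signature) where
  open Terms 𝓢

  infixl 9 _∘ˢ_

  _∘ˢ_ : Subst → Renaming → Subst
  (γ ∘ˢ π) x = γ (π x)

  mutual
    []-⟨⟩ : ∀ {κ} (t : Term κ) (π : Renaming) (γ : Subst) → t [ ⟨ π ⟩ ] [ γ ] ≡ t [ γ ∘ˢ π ]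
    []-⟨⟩ (var x)    π γ = refl
    []-⟨⟩ (fun f ts) π γ = cong (fun f) ([]*-⟨⟩ ts π γ)

    []*-⟨⟩ : ∀ {ιs} (ts : All Term ιs) (π : Renaming) (γ : Subst) →
             ts [ ⟨ π ⟩ ]* [ γ ]* ≡ ts [ γ ∘ˢ π ]*
    []*-⟨⟩ []       π γ = refl
    []*-⟨⟩ (t ∷ ts) π γ = cong₂ _∷_ ([]-⟨⟩ t π γ) ([]*-⟨⟩ ts π γ)

  Vars-rename : ∀ {κ κ′} {t : Term κ} {x : Var κ′} (π : Renaming) →
                (κ′ , x) ∈ Vars t → (κ′ , π x) ∈ Vars (t [ ⟨ π ⟩ ])
  Vars-rename π here = here
  Vars-rename {x = x} π (arg {ts = ts} p x∈) =
    arg p (subst (λ s → Vars s (_ , π x)) (sym (lookup-[] ts ⟨ π ⟩ p)) (Vars-rename π x∈))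

  Vars-rename⁻ : ∀ {κ κ′} (t : Term κ) {y : Var κ′} (π : Renaming) →
                 (κ′ , y) ∈ Vars (t [ ⟨ π ⟩ ]) → ∃[ x ] (κ′ , x) ∈ Vars t × y ≡ π x
  Vars-rename⁻ (var x)    π here = x , here , refl
  Vars-rename⁻ (fun f ts) π (arg p y∈) =
    let x , x∈ , eq = args ts p y∈ in x , arg p x∈ , eq
    where
    -- Walking through the tuple keeps the recursion structural, which a call on `All.lookup ts p`
    -- would not be.
    args : ∀ {ιs ι κ′} {y : Var κ′} (ts : All Term ιs) (p : ι ∈ˡ ιs) →
           (κ′ , y) ∈ Vars (All.lookup (ts [ ⟨ π ⟩ ]*) p) →
           ∃[ x ] (κ′ , x) ∈ Vars (All.lookup ts p) × y ≡ π x
    args (t ∷ ts) (here refl) y∈ = Vars-rename⁻ t π y∈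
    args (t ∷ ts) (there p)   y∈ = args ts p y∈

  IsValue⇒GroundLogical : ∀ {κ} {t : Term κ} → IsValue t → GroundLogical t
  IsValue⇒GroundLogical (isValue v) = fun tt λ ()

  -- The intersection serves two uses: for `X = LVar` membership in `X` yields a value, and for
  -- `X = U` the information lies in occurrence in `t`.
  GroundLogical-[]⁺ : ∀ {κ X} {t : Term κ} (γ : Subst) → TheoryTerms X t →
                      (∀ {κ′} {x : Var κ′} → (κ′ , x) ∈ X ∩ Vars t → GroundLogical (γ x)) →
                      GroundLogical (t [ γ ])
  GroundLogical-[]⁺ γ (var x∈X) h = h (x∈X , here)
  GroundLogical-[]⁺ γ (fun {ts = ts} f∈ ts∈) h = fun f∈ λ p →
    subst GroundLogical (sym (lookup-[] ts γ p))
      (GroundLogical-[]⁺ γ (ts∈ p) λ (x∈X , x∈t) → h (x∈X , arg p x∈t))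

  GroundLogical-[]⁻ : ∀ {κ κ′} {t : Term κ} {x : Var κ′} (γ : Subst) →
                      GroundLogical (t [ γ ]) → (κ′ , x) ∈ Vars t → GroundLogical (γ x)
  GroundLogical-[]⁻ γ g here = g
  GroundLogical-[]⁻ γ (fun f∈ ts∈) (arg {ts = ts} p x∈) =
    GroundLogical-[]⁻ γ (subst GroundLogical (lookup-[] ts γ p) (ts∈ p)) x∈

  mutual
    -- Substitution keeps every function symbol of `t` in place, and variables are logical.
    -- Contrapositively, no instance of a non-logical left-hand side is logical.
    Logical-[]⁻ : ∀ {κ X} (t : Term κ) (γ : Subst) → TheoryTerms X (t [ γ ]) → Logical t
    Logical-[]⁻ (var x)    γ g            = var tt
    Logical-[]⁻ (fun f ts) γ (fun f∈ ts∈) = fun f∈ (Logical-[]*⁻ ts γ ts∈)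

    Logical-[]*⁻ : ∀ {ιs X} (ts : All Term ιs) (γ : Subst) →
                   (∀ {ι} (p : ι ∈ˡ ιs) → TheoryTerms X (All.lookup (ts [ γ ]*) p)) →
                   ∀ {ι} (p : ι ∈ˡ ιs) → Logical (All.lookup ts p)
    Logical-[]*⁻ (t ∷ ts) γ ts∈ (here refl) = Logical-[]⁻ t γ (ts∈ (here refl))
    Logical-[]*⁻ (t ∷ ts) γ ts∈ (there p)   = Logical-[]*⁻ ts γ (λ q → ts∈ (there q)) p

  GroundLogical⇒Vars-empty : ∀ {κ} {t : Term κ} → GroundLogical t → ∀ {x} → x ∉ Vars t
  GroundLogical⇒Vars-empty (fun f∈ ts∈) (arg p x∈) = GroundLogical⇒Vars-empty (ts∈ p) x∈

  mutual
    -- Decidability lets `normalise` be defined on all terms, although only ground logical ones have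
    -- a value.
    groundLogical? : ∀ {κ} (t : Term κ) → Dec (GroundLogical t)
    groundLogical? (var x) = no λ { (var ()) }
    groundLogical? (fun (termSym f) ts) = no λ { (fun () _) }
    groundLogical? (fun (theorySym f) ts) with groundLogical*? ts
    ... | yes ts∈ = yes (fun tt ts∈)
    ... | no  ts∉ = no λ { (fun _ ts∈) → ts∉ ts∈ }
    groundLogical? (fun (value v) []) = yes (fun tt λ ())

    groundLogical*? : ∀ {ιs} (ts : All Term ιs) →
                      Dec (∀ {ι} (p : ι ∈ˡ ιs) → GroundLogical (All.lookup ts p))
    groundLogical*? [] = yes λ ()
    groundLogical*? (t ∷ ts) with groundLogical? t | groundLogical*? ts
    ... | yes t∈ | yes ts∈ = yes λ { (here refl) → t∈ ; (there p) → ts∈ p }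
    ... | no  t∉ | _       = no λ h → t∉ (h (here refl))
    ... | _      | no ts∉  = no λ h → ts∉ λ p → h (there p)

-- Evaluation of ground logical terms and validity.

module Evaluation (𝓢 : Signature) (𝓣 : Theory 𝓢) where
  open Rules 𝓢 𝓣
  open TermProperties 𝓢

  -- Congruence of evaluation, shared by the normalisation of substitutions and by calculation steps
  -- below the root.
  fun-⇓ : ∀ {ιs κ} {f : Sym ιs κ} (ts : All Term ιs) {us : All Term ιs} (f∈ : f ∈ Σtheory)
          (ts∈ : ∀ {ι} (p : ι ∈ˡ ιs) → GroundLogical (All.lookup ts p)) →
          (∀ {ι} (p : ι ∈ˡ ιs) → All.lookup us p ⇓ ⟦ ts∈ p ⟧) →
          fun f us ⇓ ⟦ fun {f = f} {ts} f∈ ts∈ ⟧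
  fun-⇓ {f = theorySym f} _ _ ts∈ us⇓ =
    fun tt (λ p → proj₁ (us⇓ p)) , cong (𝓙-fun f) (tabulate-cong (λ p → proj₂ (us⇓ p)))
  fun-⇓ {f = value v} _ _ ts∈ us⇓ = fun tt (λ p → proj₁ (us⇓ p)) , refl

  -- Groundness proofs contain functions, so they are compared through the values they compute
  -- instead of being identified.
  ⟦⟧-irrelevant : ∀ {κ} {t : Term κ} (g h : GroundLogical t) → ⟦ g ⟧ ≡ ⟦ h ⟧
  ⟦⟧-irrelevant (fun {f = theorySym f} _ ts∈) (fun _ ts∈′) =
    cong (𝓙-fun f) (tabulate-cong (λ p → ⟦⟧-irrelevant (ts∈ p) (ts∈′ p)))
  ⟦⟧-irrelevant (fun {f = value v} _ _) (fun _ _) = refl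

  ⇓-unique : ∀ {κ} {t : Term κ} {a b : 𝓘 κ} → t ⇓ a → t ⇓ b → a ≡ b
  ⇓-unique (g , refl) (h , refl) = ⟦⟧-irrelevant g h

  GroundLogical⇒OccursInΣtheory : ∀ {κ} {t : Term κ} → GroundLogical t → OccursInΣtheory κ
  GroundLogical⇒OccursInΣtheory (fun {f = f} f∈ _) = _ , _ , f , f∈ , inj₁ refl

  -- Surjectivity of `𝓙-val`, which is available because the head symbol of the term witnesses that
  -- its sort occurs in the theory.
  valueOf : ∀ {κ} {t : Term κ} (g : GroundLogical t) → ∃[ v ] 𝓙-val v ≡ ⟦ g ⟧
  valueOf g =
    let v , eq = proj₂ (𝓙-val-unique (GroundLogical⇒OccursInΣtheory g)) ⟦ g ⟧ in v , eq refl

  normalise : ∀ {κ} → Term κ → Term κ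
  normalise t with groundLogical? t
  ... | yes g = fun (value (proj₁ (valueOf g))) []
  -- A default: the lemmas on `normalise` all assume a ground logical term.
  ... | no  _ = t

  normalise-IsValue : ∀ {κ} {t : Term κ} → GroundLogical t → IsValue (normalise t)
  normalise-IsValue {t = t} g with groundLogical? t
  ... | yes h = isValue _
  ... | no ¬g = ⊥-elim (¬g g)

  normalise-⇓ : ∀ {κ} {t : Term κ} (g : GroundLogical t) → normalise t ⇓ ⟦ g ⟧
  normalise-⇓ {t = t} g with groundLogical? t
  ... | yes h = fun tt (λ ()) , trans (proj₂ (valueOf h)) (⟦⟧-irrelevant h g)
  ... | no ¬g = ⊥-elim (¬g g)

  normaliseˢ : Subst → Subst
  normaliseˢ γ x = normalise (γ x)

  mutual
    -- The value of an instance depends on the substitution only through the values of the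
    -- substituted terms.
    ⟦⟧-normaliseˢ : ∀ {κ} (t : Term κ) (γ : Subst) (g : GroundLogical (t [ γ ])) →
                    t [ normaliseˢ γ ] ⇓ ⟦ g ⟧
    ⟦⟧-normaliseˢ (var x)    γ g            = normalise-⇓ g
    ⟦⟧-normaliseˢ (fun f ts) γ (fun f∈ ts∈) = fun-⇓ (ts [ γ ]*) f∈ ts∈ (⟦⟧-normaliseˢ* ts γ ts∈)

    ⟦⟧-normaliseˢ* : ∀ {ιs} (ts : All Term ιs) (γ : Subst)
                     (ts∈ : ∀ {ι} (p : ι ∈ˡ ιs) → GroundLogical (All.lookup (ts [ γ ]*) p))
                     {ι} (p : ι ∈ˡ ιs) → All.lookup (ts [ normaliseˢ γ ]*) p ⇓ ⟦ ts∈ p ⟧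
    ⟦⟧-normaliseˢ* (t ∷ ts) γ ts∈ (here refl) = ⟦⟧-normaliseˢ t γ (ts∈ (here refl))
    ⟦⟧-normaliseˢ* (t ∷ ts) γ ts∈ (there p)   = ⟦⟧-normaliseˢ* ts γ (λ q → ts∈ (there q)) p

  ⇓-normaliseˢ : ∀ {κ} (t : Term κ) (γ : Subst) {a : 𝓘 κ} → t [ γ ] ⇓ a → t [ normaliseˢ γ ] ⇓ a
  ⇓-normaliseˢ t γ (g , refl) = ⟦⟧-normaliseˢ t γ g

  Valid⇒⇓ : ∀ {φ : Term bool} → GroundLogical φ → Valid φ → φ ⇓ true𝓘
  Valid⇒⇓ {φ} g valid =
    -- The identity substitution is admissible: a ground term has no variables that it would have to
    -- map to values.
    subst (_⇓ true𝓘) ([]-var φ) (valid var λ x∈ → ⊥-elim (GroundLogical⇒Vars-empty g x∈))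
    where
    mutual
      []-var : ∀ {κ} (t : Term κ) → t [ var ] ≡ t
      []-var (var x)    = refl
      []-var (fun f ts) = cong (fun f) ([]*-var ts)

      []*-var : ∀ {ιs} (ts : All Term ιs) → ts [ var ]* ≡ ts
      []*-var []       = refl
      []*-var (t ∷ ts) = cong₂ _∷_ ([]-var t) ([]*-var ts)

  -- γ need not map the variables of s to values, only to ground logical terms, so
  -- validity is applied to the normalised substitution.
  Valid[⇒]-apply : ∀ {κ} {φ : Term bool} {s t : Term κ} {_∼_ : Rel (𝓘 κ) 0ℓ}
                   (γ : Subst) {a b : 𝓘 κ} →
                   Valid[ φ ⇒ s ⟨ _∼_ ⟩ t ] → φ [ γ ] ⇓ true𝓘 →
                   s [ γ ] ⇓ a → t [ γ ] ⇓ b → a ∼ b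
  Valid[⇒]-apply {φ = φ} {s} {t} {_∼_} γ valid φ⇓ s⇓ t⇓ =
    let _ , _ , s⇓′ , t⇓′ , a∼b = valid (normaliseˢ γ)
          (λ { (inj₁ x∈φ)        → normalise-IsValue (GroundLogical-[]⁻ γ (proj₁ φ⇓) x∈φ)
             ; (inj₂ (inj₁ x∈s)) → normalise-IsValue (GroundLogical-[]⁻ γ (proj₁ s⇓) x∈s)
             ; (inj₂ (inj₂ x∈t)) → normalise-IsValue (GroundLogical-[]⁻ γ (proj₁ t⇓) x∈t) })
          (⇓-normaliseˢ φ γ φ⇓)
    in subst₂ _∼_ (⇓-unique s⇓′ (⇓-normaliseˢ s γ s⇓)) (⇓-unique t⇓′ (⇓-normaliseˢ t γ t⇓)) a∼b

-- Reduction of ground logical terms and of projected arguments.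

module Reduction (𝓢 : Signature) (𝓣 : Theory 𝓢) (R : Rules.RuleSet 𝓢 𝓣) where
  open LCTRS 𝓢 𝓣 R
  open TermProperties 𝓢
  open Evaluation 𝓢 𝓣

  GroundLogical⇒¬→rule : ∀ {κ} {s t : Term κ} → GroundLogical s → ¬ s →rule t
  GroundLogical⇒¬→rule g (root (rule ρ _ γ _)) =
    Rule.lhs-not-logical ρ (Logical-[]⁻ (Rule.lhs ρ) γ g)
  GroundLogical⇒¬→rule (fun _ ts∈) (arg p s→t) = GroundLogical⇒¬→rule (ts∈ p) s→t

  ⟦⟧-→calc : ∀ {κ} {s t : Term κ} (g : GroundLogical s) → s →calc t → t ⇓ ⟦ g ⟧
  ⟦⟧-→calc g (root (calc f ts _ _ _ (_ , a , s⇓a , h , eq))) =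
    h , trans eq (⇓-unique s⇓a (g , refl))
  ⟦⟧-→calc (fun f∈ ts∈) (arg {ts = ts} p {t} s→t) =
    fun-⇓ ts f∈ ts∈ λ q →
      Sum.[ (λ eq → subst (_⇓ ⟦ ts∈ q ⟧) (sym eq) (ts∈ q , refl)) , ⟦⟧-→calc (ts∈ q) ]′
        (lookup-≔ _→calc_ ts p s→t q)

  ⇓-→R : ∀ {κ} {s t : Term κ} {a : 𝓘 κ} → s ⇓ a → s →R t → t ⇓ a
  ⇓-→R (g , _)    (inj₁ s→t) = ⊥-elim (GroundLogical⇒¬→rule g s→t)
  ⇓-→R (g , refl) (inj₂ s→t) = ⟦⟧-→calc g s→t

  infix 4 _[_]⇓_

  -- The equation fixes the sort, which depends on the projection. Keeping the substitution separate
  -- retains the uninstantiated term `s`, of which the ordering conditions speak.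
  _[_]⇓_ : ∀ {ι} → ∃ Term → Subst → 𝓘 ι → Set
  _[_]⇓_ {ι} p γ a = Σ[ s ∈ Term ι ] p ≡ (ι , s) × s [ γ ] ⇓ a

  -- All steps happen inside arguments of the sharped symbol, so each one either leaves the
  -- projected argument alone or rewrites it, preserving its value.
  ⇓-project-→R♯ : ∀ {ι} {a : 𝓘 ι} (ν : Projection) {s t : Term♯} (γ δ : Subst) →
                  Star _→R♯_ (s [ γ ]♯) (t [ δ ]♯) →
                  project ν s [ γ ]⇓ a → project ν t [ δ ]⇓ a
  ⇓-project-→R♯ {ι} {a} ν {s} {t} γ δ s→t s⇓ = from t (steps s→t (to s s⇓))
    where
    -- Intermediate terms of the reduction are not given as instances, so the substitution is
    -- applied beforehand.
    ⇓′ : ∃ Term → Set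
    ⇓′ p = Σ[ s ∈ Term ι ] p ≡ (ι , s) × s ⇓ a

    instance-project : ∀ t (γ : Subst) →
      project ν (t [ γ ]♯) ≡ (proj₁ (project ν t) , proj₂ (project ν t) [ γ ])
    instance-project (sharp f d ts) γ = cong (_ ,_) (lookup-[] ts γ (∈-lookup (ν f d)))

    to : ∀ s → project ν s [ γ ]⇓ a → ⇓′ (project ν (s [ γ ]♯))
    to s (s′ , eq , s′⇓) =
      s′ [ γ ] , trans (instance-project s γ) (cong (λ p → proj₁ p , proj₂ p [ γ ]) eq) , s′⇓

    from′ : ∀ p → ⇓′ (proj₁ p , proj₂ p [ δ ]) → p [ δ ]⇓ a
    from′ (_ , t) (_ , refl , t⇓) = t , refl , t⇓

    from : ∀ t → ⇓′ (project ν (t [ δ ]♯)) → project ν t [ δ ]⇓ a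
    from t t⇓ = from′ (project ν t) (subst ⇓′ (instance-project t δ) t⇓)

    step′ : ∀ {κ} {s t : Term κ} → s →R t → ⇓′ (κ , s) → ⇓′ (κ , t)
    step′ s→t (_ , refl , s⇓) = _ , refl , ⇓-→R s⇓ s→t

    step : ∀ {s t} → s →R♯ t → ⇓′ (project ν s) → ⇓′ (project ν t)
    step (arg {f = f} {d} {ts} p s→t) s⇓ =
      Sum.[ (λ eq → subst (λ u → ⇓′ (_ , u)) (sym eq) s⇓) , (λ s→t′ → step′ s→t′ s⇓) ]′
        (lookup-≔ _→R_ ts p s→t (∈-lookup (ν f d)))

    steps : ∀ {s t} → Star _→R♯_ s t → ⇓′ (project ν s) → ⇓′ (project ν t)
    steps ε           s⇓ = s⇓
    steps (s→u ◅ u→t) s⇓ = steps u→t (step s→u s⇓)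

  -- Renamed dependency pairs.

  []♯-⟨⟩ : ∀ (t : Term♯) (π : Renaming) (γ : Subst) → t [ ⟨ π ⟩ ]♯ [ γ ]♯ ≡ t [ γ ∘ˢ π ]♯
  []♯-⟨⟩ (sharp f d ts) π γ = cong (sharp f d) ([]*-⟨⟩ ts π γ)

  Vars♯-rename : ∀ {t : Term♯} {κ} {x : Var κ} (π : Renaming) →
                 (κ , x) ∈ Vars♯ t → (κ , π x) ∈ Vars♯ (t [ ⟨ π ⟩ ]♯)
  Vars♯-rename {x = x} π (arg {ts = ts} p x∈) =
    arg p (subst (λ s → Vars s (_ , π x)) (sym (lookup-[] ts ⟨ π ⟩ p)) (Vars-rename π x∈))

  Vars♯-rename⁻ : ∀ (t : Term♯) {κ} {y : Var κ} (π : Renaming) →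
                  (κ , y) ∈ Vars♯ (t [ ⟨ π ⟩ ]♯) → ∃[ x ] (κ , x) ∈ Vars♯ t × y ≡ π x
  Vars♯-rename⁻ (sharp f d ts) π (arg p y∈) =
    let x , x∈ , eq = Vars-rename⁻ (All.lookup ts p) π
                        (subst (λ s → Vars s _) (lookup-[] ts ⟨ π ⟩ p) y∈)
    in x , arg p x∈ , eq

  -- Injectivity handles the negative part of `LVar`: a variable outside the left-hand side must not
  -- be renamed to one inside it.
  RespectedBy-rename⁻ : ∀ (ρ : Rule♯) (π : Renaming) (γ : Subst) →
                        (∀ {κ} → Injective _≡_ _≡_ (π {κ})) →
                        Rule♯.RespectedBy (Rule♯.rename ρ π) γ →
                        Rule♯.RespectedBy ρ (γ ∘ˢ π)
  RespectedBy-rename⁻ ρ π γ π-injective (values , valid) =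
    (λ x∈ → values (LVar-rename x∈)) , subst Valid ([]-⟨⟩ constraint π γ) valid
    where
    open Rule♯ ρ

    LVar-rename : ∀ {κ} {x : Var κ} → (κ , x) ∈ LVar → (κ , π x) ∈ Rule♯.LVar (rename π)
    LVar-rename (inj₁ x∈φ)         = inj₁ (Vars-rename π x∈φ)
    LVar-rename (inj₂ (x∈r , x∉l)) = inj₂ (Vars♯-rename π x∈r , λ πx∈l →
      let _ , y∈l , eq = Vars♯-rename⁻ lhs π πx∈l
      in x∉l (subst (λ y → (_ , y) ∈ Vars♯ lhs) (sym (π-injective eq)) y∈l))

  RespectedBy⇒constraint-⇓ : ∀ (ρ : Rule♯) (γ : Subst) → Rule♯.RespectedBy ρ γ →
                             Rule♯.constraint ρ [ γ ] ⇓ true𝓘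
  RespectedBy⇒constraint-⇓ ρ γ (values , valid) =
    Valid⇒⇓ (GroundLogical-[]⁺ γ (Rule♯.constraint-log ρ) λ (_ , x∈φ) →
               IsValue⇒GroundLogical (values (inj₁ x∈φ)))
            valid

  -- Infinite chains and their tails.

  module _ {P : Pred Rule♯ 0ℓ} (chain : InfiniteChain P) where
    open InfiniteChain chain

    -- Absorbing the renaming gives each pair its own substitution, so that conditions on the
    -- original pairs apply directly.
    subst-at : ℕ → Subst
    subst-at i = γ ∘ˢ π i

    respects-at : ∀ i → Rule♯.RespectedBy (pair i) (subst-at i)
    respects-at i = RespectedBy-rename⁻ (pair i) (π i) γ (π-injective i) (respects i)

    connected-at : ∀ i → Star _→R♯_ (Rule♯.rhs (pair i) [ subst-at i ]♯)
                                    (Rule♯.lhs (pair (suc i)) [ subst-at (suc i) ]♯)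
    connected-at i = subst₂ (Star _→R♯_) ([]♯-⟨⟩ (Rule♯.rhs (pair i)) (π i) γ)
                       ([]♯-⟨⟩ (Rule♯.lhs (pair (suc i))) (π (suc i)) γ) (connected i)

    -- Membership in `Q` is asked of the tail only. With `n = 0` this merely changes the set of
    -- pairs.
    drop-chain : ∀ {Q : Pred Rule♯ 0ℓ} n → (∀ i → pair (i + n) ∈ Q) → InfiniteChain Q
    drop-chain n pair∈Q = record
      { pair        = λ i → pair (i + n)
      ; pair∈P      = pair∈Q
      ; π           = λ i → π (i + n)
      ; π-injective = λ i → π-injective (i + n)
      ; disjoint    = λ i≢j → disjoint (λ eq → i≢j (+-cancelʳ-≡ n _ _ eq))
      ; γ           = γ
      ; respects    = λ i → respects (i + n)
      ; connected   = λ i → connected (i + n)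
      ; minimal     = λ i → minimal (i + n)
      }

-- Descent on projected values along a chain.

theorem10 :
  (𝓢 : Signature) (𝓣 : Theory 𝓢) (R : Rules.RuleSet 𝓢 𝓣) →
  let open LCTRS 𝓢 𝓣 R in
  (P : Pred Rule♯ 0ℓ) → P ⊆ DependencyPair →
  (ι : Sort) (ν : Projection) →
  let l̄ = λ (ρ : Rule♯) → project ν (Rule♯.lhs ρ)
      r̄ = λ (ρ : Rule♯) → project ν (Rule♯.rhs ρ)
  in
  (∀ ρ → ρ ∈ P → HasSort ι (l̄ ρ) × Logical′ (l̄ ρ) → HasSort ι (r̄ ρ) × Logical′ (r̄ ρ)) →
  (_≻_ : Rel (𝓘 ι) 0ℓ) → IsStrictPartialOrder _≡_ _≻_ → WellFounded (flip _≻_) →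
  (_≽_ : Rel (𝓘 ι) 0ℓ) → IsPreorder _≡_ _≽_ →
  (∀ {a b c} → a ≻ b → b ≽ c → a ≻ c) →
  (P₁ P₂ : Pred Rule♯ 0ℓ) → P ≐ P₁ ∪ P₂ →
  (∀ ρ → ρ ∈ P → HasSort ι (l̄ ρ) × Logical′ (l̄ ρ) →
    (HasSort ι (r̄ ρ) × Logical′ (r̄ ρ)) × Vars′ (r̄ ρ) ⊆ Vars′ (l̄ ρ)) →
  (∀ ρ → ρ ∈ P → ρ ∈ P₁ →
    HasSort ι (l̄ ρ) × TheoryTerms′ (Rule♯.LVar ρ) (l̄ ρ)) →
  (∀ ρ → ρ ∈ P → (s t : Term ι) → l̄ ρ ≡ (ι , s) → r̄ ρ ≡ (ι , t) → Logical s →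
    (ρ ∈ P₁ → Valid[ Rule♯.constraint ρ ⇒ s ⟨ _≻_ ⟩ t ]) ×
    (ρ ∈ P₂ → Valid[ Rule♯.constraint ρ ⇒ s ⟨ _≽_ ⟩ t ])) →
  ChainFree P ⇔ ChainFree P₂
theorem10 𝓢 𝓣 R P _ ι ν _ _≻_ _ ≻-wf _≽_ _ ≻-≽ P₁ P₂ (P⊆ , ⊆P) logical-rhs P₁-lhs ordered =
  mk⇔ (λ free chain → free (drop-chain chain 0 λ i → ⊆P (inj₂ (pair∈P chain (i + 0)))))
      (λ free chain → free (drop-chain chain 0 λ i → pair∈P₂ chain free (i + 0)))
  where
  open LCTRS 𝓢 𝓣 R
  open TermProperties 𝓢
  open Evaluation 𝓢 𝓣
  open Reduction 𝓢 𝓣 R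
  open InfiniteChain using (pair; pair∈P)

  l̄ r̄ : Rule♯ → ∃ Term
  l̄ ρ = project ν (Rule♯.lhs ρ)
  r̄ ρ = project ν (Rule♯.rhs ρ)

  P₁-lhs-⇓ : ∀ {ρ} (γ : Subst) → ρ ∈ P₁ → Rule♯.RespectedBy ρ γ →
             Σ[ a ∈ 𝓘 ι ] l̄ ρ [ γ ]⇓ a
  P₁-lhs-⇓ {ρ} γ ρ∈P₁ (values , _) = evaluate (l̄ ρ) (P₁-lhs ρ (⊆P (inj₁ ρ∈P₁)) ρ∈P₁)
    where
    -- Abstracting the projection to `p` lets the sort equation be matched with `refl`.
    evaluate : ∀ p → HasSort ι p × TheoryTerms′ (Rule♯.LVar ρ) p → Σ[ a ∈ 𝓘 ι ] p [ γ ]⇓ a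
    evaluate (_ , s) (refl , s-theory) =
      let g = GroundLogical-[]⁺ γ s-theory λ (x∈ , _) → IsValue⇒GroundLogical (values x∈)
      in ⟦ g ⟧ , s , refl , g , refl

  decrease : ∀ {ρ} (γ : Subst) {a : 𝓘 ι} → ρ ∈ P → Rule♯.RespectedBy ρ γ → l̄ ρ [ γ ]⇓ a →
             Σ[ b ∈ 𝓘 ι ] r̄ ρ [ γ ]⇓ b × (ρ ∈ P₁ → a ≻ b) × (ρ ∈ P₂ → a ≽ b)
  decrease {ρ} γ {a} ρ∈P respected (s , l̄≡ , s⇓) =
    evaluate (r̄ ρ) refl
      (logical-rhs ρ ρ∈P
        (subst (λ p → HasSort ι p × Logical′ p) (sym l̄≡) (refl , s-logical)))
    where
    s-logical : Logical s
    s-logical = Logical-[]⁻ s γ (proj₁ s⇓)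

    φ⇓ : Rule♯.constraint ρ [ γ ] ⇓ true𝓘
    φ⇓ = RespectedBy⇒constraint-⇓ ρ γ respected

    evaluate : ∀ p → r̄ ρ ≡ p → (HasSort ι p × Logical′ p) × Vars′ p ⊆ Vars′ (l̄ ρ) →
               Σ[ b ∈ 𝓘 ι ] p [ γ ]⇓ b × (ρ ∈ P₁ → a ≻ b) × (ρ ∈ P₂ → a ≽ b)
    evaluate (_ , t) r̄≡ ((refl , t-logical) , Vars⊆) =
      ⟦ g ⟧ , (t , refl , g , refl) ,
      (λ ρ∈P₁ → Valid[⇒]-apply {_∼_ = _≻_} γ (proj₁ valid ρ∈P₁) φ⇓ s⇓ (g , refl)) ,
      (λ ρ∈P₂ → Valid[⇒]-apply {_∼_ = _≽_} γ (proj₂ valid ρ∈P₂) φ⇓ s⇓ (g , refl))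
      where
      g : GroundLogical (t [ γ ])
      -- Each variable of `t` occurs in `s`, and its image is ground logical because the instance of
      -- `s` is.
      g = GroundLogical-[]⁺ γ t-logical λ (_ , x∈t) →
            GroundLogical-[]⁻ γ (proj₁ s⇓) (subst (λ p → _ ∈ Vars′ p) l̄≡ (Vars⊆ x∈t))

      valid = ordered ρ ρ∈P s t l̄≡ r̄≡ s-logical

  module _ (chain : InfiniteChain P) (P₂-free : ChainFree P₂) where

    Evaluates : ℕ → 𝓘 ι → Set
    Evaluates i a = l̄ (pair chain i) [ subst-at chain i ]⇓ a

    next : ∀ {i a} → Evaluates i a →
           Σ[ b ∈ 𝓘 ι ] Evaluates (suc i) b ×
             (pair chain i ∈ P₁ → a ≻ b) × (pair chain i ∈ P₂ → a ≽ b)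
    next {i} i⇓ =
      let b , r⇓ , rel = decrease (subst-at chain i) (pair∈P chain i) (respects-at chain i) i⇓
      in b , ⇓-project-→R♯ ν {Rule♯.rhs (pair chain i)} {Rule♯.lhs (pair chain (suc i))}
               (subst-at chain i) (subst-at chain (suc i)) (connected-at chain i) r⇓ , rel

    -- From a pair in P₁ at index i on, all values lie strictly below a, so by
    -- induction all later pairs are in P₂, and they form an infinite P₂-chain.
    P₁-free : ∀ {a} → Acc (flip _≻_) a → ∀ i → Evaluates i a → ¬ pair chain i ∈ P₁
    P₁-free {a} (acc rec) i i⇓ i∈P₁ = P₂-free (drop-chain chain (suc i) later∈P₂)
      where
      -- In `n + suc i` a successor of `n` comes out by computation, so `next` applies without
      -- transport.
      ≻later : ∀ n → Σ[ b ∈ 𝓘 ι ] Evaluates (n + suc i) b × a ≻ b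
      ∈P₂    : ∀ n {b} → Evaluates (n + suc i) b → a ≻ b → pair chain (n + suc i) ∈ P₂

      ≻later zero =
        let b , b⇓ , strict , _ = next i⇓ in b , b⇓ , strict i∈P₁
      ≻later (suc n) =
        let b , b⇓ , a≻b = ≻later n
            c , c⇓ , _ , weak = next b⇓
        in c , c⇓ , ≻-≽ a≻b (weak (∈P₂ n b⇓ a≻b))

      ∈P₂ n b⇓ a≻b =
        Sum.[ (λ n∈P₁ → ⊥-elim (P₁-free (rec a≻b) (n + suc i) b⇓ n∈P₁)) , (λ n∈P₂ → n∈P₂) ]′
          (P⊆ (pair∈P chain (n + suc i)))

      later∈P₂ : ∀ n → pair chain (n + suc i) ∈ P₂
      later∈P₂ n = let b , b⇓ , a≻b = ≻later n in ∈P₂ n b⇓ a≻b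

    pair∈P₂ : ∀ i → pair chain i ∈ P₂
    pair∈P₂ i = Sum.[ (λ i∈P₁ →
        let a , i⇓ = P₁-lhs-⇓ (subst-at chain i) i∈P₁ (respects-at chain i)
        in ⊥-elim (P₁-free (≻-wf a) i i⇓ i∈P₁)) , (λ i∈P₂ → i∈P₂) ]′
      (P⊆ (pair∈P chain i))
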